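{- Let $M$ be a closed term. Then $\mathcal{E}(M)=\sup\{w\mid \vdash^{w}M:\mathbf{0}\text{ is derivable}\}$, and $M$ is positively almost surely terminating (i.e. $\mathcal{E}(M)<\infty$) if and only if $\sup\{w\mid \vdash^{w}M:\mathbf{0}\text{ is derivable}\}<\infty$.
   Context: Terms: values $V ::= x \mid \lambda x.M$; terms $M ::= V \mid VV \mid M\oplus M \mid \mathtt{let}\ x = M\ \mathtt{in}\ M$; $M\{V/x\}$ is capture-avoiding substitution. A multidistribution on terms is a finite multiset $\langle p_iM_i\rangle_{i\in I}$ with $p_i\in(0,1]$, $\sum_ip_i\le1$; $\sqcup$ is multiset union and $q\cdot\langle p_iM_i\rangle=\langle (qp_i)M_i\rangle$. One-step reduction: $(\lambda x.M)V\to\langle 1\,M\{V/x\}\rangle$; $\mathtt{let}\ x=V\ \mathtt{in}\ M\to\langle 1\,M\{V/x\}\rangle$; $M\oplus N\to\langle\tfrac12 M,\tfrac12 N\rangle$; if $N\to\langle p_iN_i\rangle_{i\in I}$ then $\mathtt{let}\ x=N\ \mathtt{in}\ M\to\langle p_i(\mathtt{let}\ x=N_i\ \mathtt{in}\ M)\rangle_{i\in I}$. Lifting to multidistributions of closed terms: $\langle p_iM_i\rangle_{i\in I}\Rightarrow\bigsqcup_i p_i\cdot\mathbf{m}_i$ where $\mathbf{m}_i=\langle 1M_i\rangle$ if $M_i$ is a value and $M_i\to\mathbf{m}_i$ otherwise. For closed $M$ let $\langle 1M\rangle=\mathbf{m}_0\Rightarrow\mathbf{m}_1\Rightarrow\cdots$;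 $\mathcal{P}_k(M)$ is the sum of the probabilities of the values occurring in $\mathbf{m}_k$; $\mathcal{E}_k(M)=\sum_{j=0}^{k-1}(1-\mathcal{P}_j(M))$ and $\mathcal{E}(M)=\sup_k\mathcal{E}_k(M)$ (possibly $\infty$). Types: arrow types $\mathtt{A} ::= \mathcal{M}\to \mathtt{a}$; intersection types $\mathcal{M} ::= [q_1\cdot \mathtt{A}_1,\dots,q_n\cdot\mathtt{A}_n]$ ($n\ge0$, scale factors $q_i\in(0,1]\cap\mathbb{Q}$); type distributions $\mathtt{a} ::= \langle p_1\mathcal{M}_1,\dots,p_n\mathcal{M}_n\rangle$ ($n\ge0$, $p_i\in(0,1]$, $\sum p_i\le1$); $\mathbf{0}$ is the empty type distribution. Scaling: $u\cdot[q_i\cdot\mathtt{A}_i]_i=[(uq_i)\cdot \mathtt{A}_i]_i$, $u\cdot\langle p_i\mathcal{M}_i\rangle_i=\langle (up_i)\mathcal{M}_i\rangle_i$; $\uplus,\sqcup$ multiset unions. Typing contexts map variables to intersection types (finitely many nonempty), pointwise $\uplus$ and scaling. Rules for $\Gamma\vdash^{w}M:\tau$ ($w\in\mathbb{Q}$): (Var) $x:\mathcal{M}\vdash^0 x:\mathcal{M}$. (Zero) $\vdash^0 M:\mathbf{0}$. (@) from $\Gamma\vdash^{w}V:[1\cdot(\mathcal{M}\to\mathtt{b})]$, $\Delta\vdash^{v}W:\mathcal{M}$ infer $\Gamma\uplus\Delta\vdash^{w+v}VW:\mathtt{b}$. ($\oplus$) from $\Gamma\vdash^{w}M:\mathtt{a}$,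 $\Delta\vdash^{v}N:\mathtt{b}$ infer $\tfrac12\cdot\Gamma\uplus\tfrac12\cdot\Delta\vdash^{\frac12 w+\frac12 v+1}M\oplus N:\tfrac12\mathtt{a}\sqcup\tfrac12\mathtt{b}$. ($\lambda$) from $\Gamma,x:\mathcal{M}\vdash^{w}M:\mathtt{b}$ infer $\Gamma\vdash^{w+1}\lambda x.M:\mathcal{M}\to\mathtt{b}$. (let) from $\Gamma\vdash^{v}N:\langle p_k\mathcal{M}_k\rangle_{k\in K}$ and $\Delta_k,x:\mathcal{M}_k\vdash^{w_k}M:\mathtt{b}_k$ ($k\in K$) infer $\Gamma\uplus_{k}p_k\cdot\Delta_k\vdash^{\sum_k p_kw_k+v+1}\mathtt{let}\ x=N\ \mathtt{in}\ M:\bigsqcup_k p_k\mathtt{b}_k$. (Val) from $\Gamma\vdash^{w}V:\mathcal{M}$ infer $\Gamma\vdash^{w}V:\langle 1\mathcal{M}\rangle$. (!) for finite possibly empty $I$, from $\Gamma_i\vdash^{w_i}V:\mathtt{A}_i$ and scale factors $q_i$ infer $\uplus_i q_i\cdot\Gamma_i\vdash^{\sum_i q_iw_i}V:[q_i\cdot\mathtt{A}_i]_{i\in I}$. -}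

module Defs where

open import Data.Nat using (ℕ; zero; suc)
open import Data.Fin using (Fin; zero; suc)
open import Data.Bool using (Bool; true; false; if_then_else_)
open import Data.List using (List; []; _∷_; _++_; map; concatMap)
open import Data.Vec using (Vec; []; _∷_; zipWith; replicate)
import Data.Vec as Vec
open import Data.Product using (_×_; _,_; ∃-syntax; Σ)
open import Data.Unit using (⊤)
open import Data.Rational using (ℚ; 0ℚ; 1ℚ; ½; _+_; _*_; _-_; _<_; _≤_)
open import Relation.Binary.PropositionalEquality using (_≡_)
open import Function.Bundles using (_⇔_)

mutual
  data Val (n : ℕ) : Set where
    var : Fin n → Val n
    lam : Term (suc n) → Val n

  data Term (n : ℕ) : Set where
    val   : Val n → Term n
    app   : Val n → Val n → Term n
    _⊕_   : Term n → Term n → Term n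
    letin : Term n → Term (suc n) → Term n

extR : ∀ {n m} → (Fin n → Fin m) → Fin (suc n) → Fin (suc m)
extR ρ zero    = zero
extR ρ (suc i) = suc (ρ i)

mutual
  renV : ∀ {n m} → (Fin n → Fin m) → Val n → Val m
  renV ρ (var i) = var (ρ i)
  renV ρ (lam t) = lam (renT (extR ρ) t)

  renT : ∀ {n m} → (Fin n → Fin m) → Term n → Term m
  renT ρ (val v)     = val (renV ρ v)
  renT ρ (app v w)   = app (renV ρ v) (renV ρ w)
  renT ρ (t ⊕ u)     = renT ρ t ⊕ renT ρ u
  renT ρ (letin t u) = letin (renT ρ t) (renT (extR ρ) u)

extS : ∀ {n m} → (Fin n → Val m) → Fin (suc n) → Val (suc m)
extS σ zero    = var zero
extS σ (suc i) = renV suc (σ i)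

mutual
  subV : ∀ {n m} → (Fin n → Val m) → Val n → Val m
  subV σ (var i) = σ i
  subV σ (lam t) = lam (subT (extS σ) t)

  subT : ∀ {n m} → (Fin n → Val m) → Term n → Term m
  subT σ (val v)     = val (subV σ v)
  subT σ (app v w)   = app (subV σ v) (subV σ w)
  subT σ (t ⊕ u)     = subT σ t ⊕ subT σ u
  subT σ (letin t u) = letin (subT σ t) (subT (extS σ) u)

_[_] : ∀ {n} → Term (suc n) → Val n → Term n
t [ v ] = subT σ t
  where
  σ : _ → _
  σ zero    = v
  σ (suc i) = var i

MDist : Set
MDist = List (ℚ × Term 0)       -- finite multiset ⟨p_i M_i⟩ (as a list)

scaleMD : ℚ → MDist → MDist
scaleMD q = map (λ { (p , t) → (q * p , t) })

isValue : ∀ {n} → Term n → Bool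
isValue (val _) = true
isValue _       = false

-- m_i as in the lifting: ⟨1 M⟩ if M is a value, otherwise the unique m with M → m.
-- (The one-step relation is deterministic and total on closed non-values.)
red : Term 0 → MDist
red (val v)               = (1ℚ , val v) ∷ []
red (app (var ()) w)
red (app (lam t) w)       = (1ℚ , t [ w ]) ∷ []
red (t ⊕ u)               = (½ , t) ∷ (½ , u) ∷ []
red (letin (val v) u)     = (1ℚ , u [ v ]) ∷ []
red (letin t u)           = map (λ { (p , t') → (p , letin t' u) }) (red t)

liftStep : MDist → MDist
liftStep = concatMap (λ { (p , t) → scaleMD p (red t) })

mseq : Term 0 → ℕ → MDist
mseq M zero    = (1ℚ , M) ∷ []
mseq M (suc k) = liftStep (mseq M k)

valMass : MDist → ℚ
valMass []             = 0ℚ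
valMass ((p , t) ∷ ms) = (if isValue t then p else 0ℚ) + valMass ms

Pk : Term 0 → ℕ → ℚ
Pk M k = valMass (mseq M k)

Ek : Term 0 → ℕ → ℚ
Ek M zero    = 0ℚ
Ek M (suc k) = Ek M k + (1ℚ - Pk M k)

-- Types (raw syntax; multisets represented as lists, taken up to the
-- deep permutation equivalence below)

data Arrow : Set where
  _⇒_ : List (ℚ × Arrow) → List (ℚ × List (ℚ × Arrow)) → Arrow

IType : Set
IType = List (ℚ × Arrow)

TDist : Set
TDist = List (ℚ × IType)

data Perm {A : Set} (R : A → A → Set) : List (ℚ × A) → List (ℚ × A) → Set where
  []    : Perm R [] []
  cons  : ∀ {p p' x x' xs xs'} → p ≡ p' → R x x' → Perm R xs xs'
        → Perm R ((p , x) ∷ xs) ((p' , x') ∷ xs')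
  swap  : ∀ {x y xs} → Perm R (x ∷ y ∷ xs) (y ∷ x ∷ xs)
  trans : ∀ {xs ys zs} → Perm R xs ys → Perm R ys zs → Perm R xs zs

data _≈A_ : Arrow → Arrow → Set where
  arr : ∀ {M M' a a'} → Perm _≈A_ M M' → Perm (Perm _≈A_) a a' → (M ⇒ a) ≈A (M' ⇒ a')

_≈M_ : IType → IType → Set
_≈M_ = Perm _≈A_

_≈D_ : TDist → TDist → Set
_≈D_ = Perm _≈M_

sumP : TDist → ℚ
sumP []             = 0ℚ
sumP ((p , _) ∷ ps) = p + sumP ps

mutual
  WFA : Arrow → Set
  WFA (M ⇒ a) = WFM M × WFD' a × (sumP a ≤ 1ℚ)

  WFM : IType → Set
  WFM []             = ⊤
  WFM ((q , A) ∷ M) = (0ℚ < q × q ≤ 1ℚ × WFA A) × WFM M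

  WFD' : List (ℚ × List (ℚ × Arrow)) → Set
  WFD' []             = ⊤
  WFD' ((p , M) ∷ a) = (0ℚ < p × p ≤ 1ℚ × WFM M) × WFD' a

scaleM : ℚ → IType → IType
scaleM u = map (λ { (q , A) → (u * q , A) })

scaleD : ℚ → TDist → TDist
scaleD u = map (λ { (p , M) → (u * p , M) })

Ctx : ℕ → Set
Ctx n = Vec IType n

∅ : ∀ {n} → Ctx n
∅ = replicate _ []

_⊎C_ : ∀ {n} → Ctx n → Ctx n → Ctx n
_⊎C_ = zipWith _++_

scaleC : ∀ {n} → ℚ → Ctx n → Ctx n
scaleC u = Vec.map (scaleM u)

single : ∀ {n} → Fin n → IType → Ctx n
single zero    M = M ∷ ∅
single (suc i) M = [] ∷ single i M

data _≈C_ : ∀ {n} → Ctx n → Ctx n → Set where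
  []  : [] ≈C []
  _∷_ : ∀ {n M M'} {Γ Γ' : Ctx n} → M ≈M M' → Γ ≈C Γ' → (M ∷ Γ) ≈C (M' ∷ Γ')

mutual
  data _⊢A⟨_⟩_∶_ {n : ℕ} : Ctx n → ℚ → Val n → Arrow → Set where
    lamR  : ∀ {Γ M w t b} → (M ∷ Γ) ⊢⟨ w ⟩ t ∶ b → Γ ⊢A⟨ w + 1ℚ ⟩ lam t ∶ (M ⇒ b)
    convA : ∀ {Γ Γ' w V A A'} → Γ ≈C Γ' → A ≈A A' → Γ ⊢A⟨ w ⟩ V ∶ A → Γ' ⊢A⟨ w ⟩ V ∶ A'

  data _⊢M⟨_⟩_∶_ {n : ℕ} : Ctx n → ℚ → Val n → IType → Set where
    varR  : ∀ {i M} → WFM M → single i M ⊢M⟨ 0ℚ ⟩ var i ∶ M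
    bangR : ∀ {Γ w V qs} → Bang V qs Γ w → Γ ⊢M⟨ w ⟩ V ∶ qs
    convM : ∀ {Γ Γ' w V M M'} → Γ ≈C Γ' → M ≈M M' → Γ ⊢M⟨ w ⟩ V ∶ M → Γ' ⊢M⟨ w ⟩ V ∶ M'

  -- premises of (!): Bang V [q_i·A_i] (⊎ q_i·Γ_i) (Σ q_i w_i)
  data Bang {n : ℕ} (V : Val n) : IType → Ctx n → ℚ → Set where
    []   : Bang V [] ∅ 0ℚ
    cons : ∀ {q A qs Γ Δ w v} → 0ℚ < q → q ≤ 1ℚ → Γ ⊢A⟨ w ⟩ V ∶ A → Bang V qs Δ v
         → Bang V ((q , A) ∷ qs) (scaleC q Γ ⊎C Δ) (q * w + v)

  data _⊢⟨_⟩_∶_ {n : ℕ} : Ctx n → ℚ → Term n → TDist → Set where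
    zeroR : ∀ {t} → ∅ ⊢⟨ 0ℚ ⟩ t ∶ []
    appR  : ∀ {Γ Δ w v V W M b} → Γ ⊢M⟨ w ⟩ V ∶ ((1ℚ , (M ⇒ b)) ∷ []) → Δ ⊢M⟨ v ⟩ W ∶ M
          → (Γ ⊎C Δ) ⊢⟨ w + v ⟩ app V W ∶ b
    oplusR : ∀ {Γ Δ w v t u a b} → Γ ⊢⟨ w ⟩ t ∶ a → Δ ⊢⟨ v ⟩ u ∶ b
          → (scaleC ½ Γ ⊎C scaleC ½ Δ) ⊢⟨ (½ * w + ½ * v) + 1ℚ ⟩ t ⊕ u ∶ (scaleD ½ a ++ scaleD ½ b)
    letR  : ∀ {Γ Δ v ws t u ks bs} → Γ ⊢⟨ v ⟩ t ∶ ks → Branches u ks Δ ws bs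
          → (Γ ⊎C Δ) ⊢⟨ (ws + v) + 1ℚ ⟩ letin t u ∶ bs
    valR  : ∀ {Γ w V M} → Γ ⊢M⟨ w ⟩ V ∶ M → Γ ⊢⟨ w ⟩ val V ∶ ((1ℚ , M) ∷ [])
    conv  : ∀ {Γ Γ' w t a a'} → Γ ≈C Γ' → a ≈D a' → Γ ⊢⟨ w ⟩ t ∶ a → Γ' ⊢⟨ w ⟩ t ∶ a'

  -- premises of (let): Branches M ⟨p_k 𝓜_k⟩ (⊎ p_k·Δ_k) (Σ p_k w_k) (⊔ p_k b_k)
  data Branches {n : ℕ} (u : Term (suc n)) : TDist → Ctx n → ℚ → TDist → Set where
    []   : Branches u [] ∅ 0ℚ []
    cons : ∀ {p M ks Δ Δs w ws b bs} → (M ∷ Δ) ⊢⟨ w ⟩ u ∶ b → Branches u ks Δs ws bs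
         → Branches u ((p , M) ∷ ks) (scaleC p Δ ⊎C Δs) (p * w + ws) (scaleD p b ++ bs)

-- sup A = sup B, expressed by: for every rational q, q < sup A iff q < sup B
SameSup : (ℚ → Set) → (ℚ → Set) → Set
SameSup A B = ∀ q → (∃[ a ] (A a × q < a)) ⇔ (∃[ b ] (B b × q < b))

SupFinite : (ℚ → Set) → Set
SupFinite A = ∃[ B ] (∀ a → A a → a ≤ B)

-- {ℰ_k(M) | k}, whose supremum is ℰ(M)
ExpSteps : Term 0 → ℚ → Set
ExpSteps M e = ∃[ k ] (e ≡ Ek M k)

TypeWeights : Term 0 → ℚ → Set
TypeWeights M w = [] ⊢⟨ w ⟩ M ∶ []

PAST : Term 0 → Set
PAST M = SupFinite (ExpSteps M)

{-# OPTIONS --safe #-}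
module Submission where

-- Soundness is by realizability rather than subject reduction: an arrow type is interpreted by its
-- action on realizers, and a type distribution by orthogonality with stacks of pending lets, where
-- "the stack costs at least r on t" means that r is bounded by some ℰₖ. Weights are potentials: a
-- value of type [qᵢ·Aᵢ] carries Σ qᵢ wᵢ, each rule adds the cost of the one step it accounts for,
-- and invariance under permutation holds because all the sums involved are commutative.
-- Completeness goes backwards along k steps of an environment machine, starting from zero types:
-- a state is typed by typing its term, its closures and its stack separately, and each machine step
-- pulls a typing of the successors back to one of weight one more than their mean. No
-- anti-substitution lemma is needed.

open import Defs
open import Data.Nat using (ℕ; zero; suc)
  renaming (_+_ to _+ℕ_; _⊔_ to _⊔ℕ_; _≤_ to _≤ℕ_; s≤s to s≤ℕs; _≤′_ to _≤′ℕ_)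
open import Data.Nat.Base using (≤′-reflexive; ≤′-step)
import Data.Nat.Properties as ℕ
open import Data.Fin using (Fin; zero; suc)
open import Data.Bool using (true; false; if_then_else_)
open import Data.List using (List; []; _∷_; _++_; map; length)
import Data.List.Properties as List
open import Data.List.Relation.Unary.All using (All; []; _∷_)
open import Data.Vec using ([]; _∷_)
import Data.Vec.Properties as Vec
open import Data.Product using (_×_; _,_; ∃-syntax; proj₁; proj₂)
open import Data.Unit using (tt)
open import Data.Rational
  using (ℚ; 0ℚ; 1ℚ; ½; _+_; _*_; _-_; _<_; _≤_; nonNegative; positive)
import Data.Rational.Properties as ℚ
open import Data.Rational.Solver
open +-*-Solver using (solve; _:=_; _:+_; _:*_; _:-_; con)
open import Function.Bundles using (_⇔_; mk⇔)
open import Relation.Binary.PropositionalEquality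
  using (_≡_; refl; sym; cong; cong₂; subst; module ≡-Reasoning) renaming (trans to infixr 4 _∙_)
open import Relation.Nullary.Decidable using (from-yes)

-- Substitution

mutual
  -- The composite is a third map, equal only pointwise, so that the hypothesis passes under binders
  -- without function extensionality. The other fusion laws below have the same form.
  renV-renV : ∀ {n m k} {ρ : Fin n → Fin m} {ρ′ : Fin m → Fin k} {ρ″ : Fin n → Fin k}
            → (∀ i → ρ′ (ρ i) ≡ ρ″ i) → ∀ v → renV ρ′ (renV ρ v) ≡ renV ρ″ v
  renV-renV eq (var i) = cong var (eq i)
  renV-renV eq (lam t) = cong lam (renT-renT (extR-extR eq) t)

  renT-renT : ∀ {n m k} {ρ : Fin n → Fin m} {ρ′ : Fin m → Fin k} {ρ″ : Fin n → Fin k}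
            → (∀ i → ρ′ (ρ i) ≡ ρ″ i) → ∀ t → renT ρ′ (renT ρ t) ≡ renT ρ″ t
  renT-renT eq (val v)     = cong val (renV-renV eq v)
  renT-renT eq (app v w)   = cong₂ app (renV-renV eq v) (renV-renV eq w)
  renT-renT eq (t ⊕ u)     = cong₂ _⊕_ (renT-renT eq t) (renT-renT eq u)
  renT-renT eq (letin t u) = cong₂ letin (renT-renT eq t) (renT-renT (extR-extR eq) u)

  extR-extR : ∀ {n m k} {ρ : Fin n → Fin m} {ρ′ : Fin m → Fin k} {ρ″ : Fin n → Fin k}
            → (∀ i → ρ′ (ρ i) ≡ ρ″ i) → ∀ i → extR ρ′ (extR ρ i) ≡ extR ρ″ i
  extR-extR eq zero    = refl
  extR-extR eq (suc i) = cong suc (eq i)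

mutual
  subV-renV : ∀ {n m k} {ρ : Fin n → Fin m} {σ : Fin m → Val k} {τ : Fin n → Val k}
            → (∀ i → σ (ρ i) ≡ τ i) → ∀ v → subV σ (renV ρ v) ≡ subV τ v
  subV-renV eq (var i) = eq i
  subV-renV eq (lam t) = cong lam (subT-renT (extS-extR eq) t)

  subT-renT : ∀ {n m k} {ρ : Fin n → Fin m} {σ : Fin m → Val k} {τ : Fin n → Val k}
            → (∀ i → σ (ρ i) ≡ τ i) → ∀ t → subT σ (renT ρ t) ≡ subT τ t
  subT-renT eq (val v)     = cong val (subV-renV eq v)
  subT-renT eq (app v w)   = cong₂ app (subV-renV eq v) (subV-renV eq w)
  subT-renT eq (t ⊕ u)     = cong₂ _⊕_ (subT-renT eq t) (subT-renT eq u)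
  subT-renT eq (letin t u) = cong₂ letin (subT-renT eq t) (subT-renT (extS-extR eq) u)

  extS-extR : ∀ {n m k} {ρ : Fin n → Fin m} {σ : Fin m → Val k} {τ : Fin n → Val k}
            → (∀ i → σ (ρ i) ≡ τ i) → ∀ i → extS σ (extR ρ i) ≡ extS τ i
  extS-extR eq zero    = refl
  extS-extR eq (suc i) = cong (renV suc) (eq i)

mutual
  renV-subV : ∀ {n m k} {σ : Fin n → Val m} {ρ : Fin m → Fin k} {τ : Fin n → Val k}
            → (∀ i → renV ρ (σ i) ≡ τ i) → ∀ v → renV ρ (subV σ v) ≡ subV τ v
  renV-subV eq (var i) = eq i
  renV-subV eq (lam t) = cong lam (renT-subT (extR-extS eq) t)

  renT-subT : ∀ {n m k} {σ : Fin n → Val m} {ρ : Fin m → Fin k} {τ : Fin n → Val k}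
            → (∀ i → renV ρ (σ i) ≡ τ i) → ∀ t → renT ρ (subT σ t) ≡ subT τ t
  renT-subT eq (val v)     = cong val (renV-subV eq v)
  renT-subT eq (app v w)   = cong₂ app (renV-subV eq v) (renV-subV eq w)
  renT-subT eq (t ⊕ u)     = cong₂ _⊕_ (renT-subT eq t) (renT-subT eq u)
  renT-subT eq (letin t u) = cong₂ letin (renT-subT eq t) (renT-subT (extR-extS eq) u)

  extR-extS : ∀ {n m k} {σ : Fin n → Val m} {ρ : Fin m → Fin k} {τ : Fin n → Val k}
            → (∀ i → renV ρ (σ i) ≡ τ i) → ∀ i → renV (extR ρ) (extS σ i) ≡ extS τ i
  extR-extS eq zero = refl
  extR-extS {σ = σ} eq (suc i) =
    renV-renV (λ _ → refl) (σ i) ∙ sym (renV-renV (λ _ → refl) (σ i)) ∙ cong (renV suc) (eq i)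

mutual
  subV-subV : ∀ {n m k} {σ : Fin n → Val m} {τ : Fin m → Val k} {υ : Fin n → Val k}
            → (∀ i → subV τ (σ i) ≡ υ i) → ∀ v → subV τ (subV σ v) ≡ subV υ v
  subV-subV eq (var i) = eq i
  subV-subV eq (lam t) = cong lam (subT-subT (extS-extS eq) t)

  subT-subT : ∀ {n m k} {σ : Fin n → Val m} {τ : Fin m → Val k} {υ : Fin n → Val k}
            → (∀ i → subV τ (σ i) ≡ υ i) → ∀ t → subT τ (subT σ t) ≡ subT υ t
  subT-subT eq (val v)     = cong val (subV-subV eq v)
  subT-subT eq (app v w)   = cong₂ app (subV-subV eq v) (subV-subV eq w)
  subT-subT eq (t ⊕ u)     = cong₂ _⊕_ (subT-subT eq t) (subT-subT eq u)
  subT-subT eq (letin t u) = cong₂ letin (subT-subT eq t) (subT-subT (extS-extS eq) u)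

  extS-extS : ∀ {n m k} {σ : Fin n → Val m} {τ : Fin m → Val k} {υ : Fin n → Val k}
            → (∀ i → subV τ (σ i) ≡ υ i) → ∀ i → subV (extS τ) (extS σ i) ≡ extS υ i
  extS-extS eq zero = refl
  extS-extS {σ = σ} eq (suc i) =
    subV-renV (λ _ → refl) (σ i) ∙ sym (renV-subV (λ _ → refl) (σ i)) ∙ cong (renV suc) (eq i)

mutual
  subV-id : ∀ {n} {σ : Fin n → Val n} → (∀ i → σ i ≡ var i) → ∀ v → subV σ v ≡ v
  subV-id eq (var i) = eq i
  subV-id eq (lam t) = cong lam (subT-id (extS-id eq) t)

  subT-id : ∀ {n} {σ : Fin n → Val n} → (∀ i → σ i ≡ var i) → ∀ t → subT σ t ≡ t
  subT-id eq (val v)     = cong val (subV-id eq v)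
  subT-id eq (app v w)   = cong₂ app (subV-id eq v) (subV-id eq w)
  subT-id eq (t ⊕ u)     = cong₂ _⊕_ (subT-id eq t) (subT-id eq u)
  subT-id eq (letin t u) = cong₂ letin (subT-id eq t) (subT-id (extS-id eq) u)

  extS-id : ∀ {n} {σ : Fin n → Val n} → (∀ i → σ i ≡ var i) → ∀ i → extS σ i ≡ var i
  extS-id eq zero    = refl
  extS-id eq (suc i) = cong (renV suc) (eq i)

-- Fusion with the identity substitution, which replaces an induction on `t`.
subT-cong : ∀ {n m} {σ τ : Fin n → Val m} → (∀ i → σ i ≡ τ i) → ∀ t → subT σ t ≡ subT τ t
subT-cong eq t = cong (subT _) (sym (subT-id (λ _ → refl) t)) ∙ subT-subT eq t

_▹_ : ∀ {n} {A : Set} → (Fin n → A) → A → Fin (suc n) → A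
(σ ▹ v) zero    = v
(σ ▹ v) (suc i) = σ i

-- Contracting a redex whose body is under a delayed substitution extends that substitution. Both
-- the realizers and the environment machine see a β-step or a fired let in this way.
subT-[] : ∀ {n m} {σ : Fin n → Val m} {v} t → (subT (extS σ) t) [ v ] ≡ subT (σ ▹ v) t
subT-[] {σ = σ} t = subT-subT (λ where
  zero    → refl
  (suc i) → subV-renV (λ _ → refl) (σ i) ∙ subV-id (λ _ → refl) (σ i)) t

-- Expected number of steps

≤-resp : ∀ {a b a′ b′} → a ≡ a′ → b ≡ b′ → a ≤ b → a′ ≤ b′
≤-resp refl refl le = le

0≤1 : 0ℚ ≤ 1ℚ
0≤1 = from-yes (0ℚ ℚ.≤? 1ℚ)

0≤½ : 0ℚ ≤ ½
0≤½ = from-yes (0ℚ ℚ.≤? ½)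

*-mono-≤ : ∀ {p a b} → 0ℚ ≤ p → a ≤ b → p * a ≤ p * b
*-mono-≤ {p} 0≤p = ℚ.*-monoˡ-≤-nonNeg p {{nonNegative 0≤p}}

-- The integral of `f` against the multidistribution; the total mass is not divided out.
avg : (Term 0 → ℚ) → MDist → ℚ
avg f []            = 0ℚ
avg f ((p , t) ∷ m) = p * f t + avg f m

-- ℰₖ by recursion on the first step, whereas `Ek` recurses on the last; they agree by `Ek≡steps`.
-- This form decomposes along evaluation contexts.
steps : ℕ → Term 0 → ℚ
steps zero    t = 0ℚ
steps (suc k) t = if isValue t then 0ℚ else 1ℚ + avg (steps k) (red t)

NonNegMD : MDist → Set
NonNegMD = All (λ pt → 0ℚ ≤ proj₁ pt)

avg-mono : ∀ {f g m} → NonNegMD m → (∀ t → f t ≤ g t) → avg f m ≤ avg g m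
avg-mono []          le = ℚ.≤-refl
avg-mono (0≤p ∷ nn) le = ℚ.+-mono-≤ (*-mono-≤ 0≤p (le _)) (avg-mono nn le)

-- `g` stands for the pattern lambda inside `red`, of which only the pointwise behaviour can be
-- stated from outside.
avg-map : ∀ f (g : ℚ × Term 0 → ℚ × Term 0) (h : Term 0 → Term 0)
        → (∀ p t → g (p , t) ≡ (p , h t)) → ∀ m → avg f (map g m) ≡ avg (λ t → f (h t)) m
avg-map f g h eq []            = refl
avg-map f g h eq ((p , t) ∷ m) rewrite eq p t = cong (p * f (h t) +_) (avg-map f g h eq m)

NonNegMD-map : ∀ (g : ℚ × Term 0 → ℚ × Term 0)
             → (∀ p t → proj₁ (g (p , t)) ≡ p) → ∀ {m} → NonNegMD m → NonNegMD (map g m)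
NonNegMD-map g eq []         = []
NonNegMD-map g eq (0≤p ∷ nn) = subst (0ℚ ≤_) (sym (eq _ _)) 0≤p ∷ NonNegMD-map g eq nn

avg-const : ∀ c m → avg (λ _ → c) m ≡ avg (λ _ → 1ℚ) m * c
avg-const c []            = sym (ℚ.*-zeroˡ c)
avg-const c ((p , t) ∷ m) = cong (p * c +_) (avg-const c m)
  ∙ solve 3 (λ p c x → p :* c :+ x :* c := (p :* con 1ℚ :+ x) :* c) refl p c _

avg-+ : ∀ f g m → avg (λ t → f t + g t) m ≡ avg f m + avg g m
avg-+ f g []            = refl
avg-+ f g ((p , t) ∷ m) = cong (p * (f t + g t) +_) (avg-+ f g m)
  ∙ solve 5 (λ p x y a b → p :* (x :+ y) :+ (a :+ b) := (p :* x :+ a) :+ (p :* y :+ b)) refl p _ _ _ _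

avg-cong : ∀ {f g} → (∀ t → f t ≡ g t) → ∀ m → avg f m ≡ avg g m
avg-cong eq []            = refl
avg-cong eq ((p , t) ∷ m) = cong₂ _+_ (cong (p *_) (eq t)) (avg-cong eq m)

avg-++ : ∀ f m m′ → avg f (m ++ m′) ≡ avg f m + avg f m′
avg-++ f []            m′ = sym (ℚ.+-identityˡ _)
avg-++ f ((p , t) ∷ m) m′ = cong (p * f t +_) (avg-++ f m m′) ∙ sym (ℚ.+-assoc (p * f t) _ _)

avg-scaleMD : ∀ f q m → avg f (scaleMD q m) ≡ q * avg f m
avg-scaleMD f q []            = sym (ℚ.*-zeroʳ q)
avg-scaleMD f q ((p , t) ∷ m) = cong (q * p * f t +_) (avg-scaleMD f q m)
  ∙ solve 4 (λ q p x a → q :* p :* x :+ q :* a := q :* (p :* x :+ a)) refl q p _ _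

avg-liftStep : ∀ f m → avg f (liftStep m) ≡ avg (λ t → avg f (red t)) m
avg-liftStep f []            = refl
avg-liftStep f ((p , t) ∷ m) = avg-++ f (scaleMD p (red t)) (liftStep m)
  ∙ cong₂ _+_ (avg-scaleMD f p (red t)) (avg-liftStep f m)

avg-dirac : ∀ f t → avg f ((1ℚ , t) ∷ []) ≡ f t
avg-dirac f t = solve 1 (λ x → con 1ℚ :* x :+ con 0ℚ := x) refl (f t)

avg-red-letin : ∀ f t u → isValue t ≡ false
              → avg f (red (letin t u)) ≡ avg (λ t′ → f (letin t′ u)) (red t)
avg-red-letin f (val v)          u ()
avg-red-letin f (app (var ()) w) u nv
avg-red-letin f (app (lam t) w)  u nv = refl
avg-red-letin f (t ⊕ t′)         u nv = refl
avg-red-letin f t@(letin _ _)    u nv = avg-map f _ (λ t′ → letin t′ u) (λ _ _ → refl) (red t)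

red-nonNeg : ∀ t → NonNegMD (red t)
red-nonNeg (val v)                        = 0≤1 ∷ []
red-nonNeg (app (var ()) w)
red-nonNeg (app (lam t) w)                = 0≤1 ∷ []
red-nonNeg (t ⊕ u)                        = 0≤½ ∷ 0≤½ ∷ []
red-nonNeg (letin (val v) u)              = 0≤1 ∷ []
red-nonNeg (letin (app (var ()) w) u)
red-nonNeg (letin (app (lam t) w) u)      = 0≤1 ∷ []
red-nonNeg (letin (t ⊕ t′) u)             = 0≤½ ∷ 0≤½ ∷ []
red-nonNeg (letin t@(letin _ _) u)        = NonNegMD-map _ (λ _ _ → refl) (red-nonNeg t)

red-mass : ∀ t → avg (λ _ → 1ℚ) (red t) ≡ 1ℚ
red-mass (val v)                    = refl
red-mass (app (var ()) w)
red-mass (app (lam t) w)            = refl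
red-mass (t ⊕ u)                    = refl
red-mass (letin (val v) u)          = refl
red-mass (letin (app (var ()) w) u)
red-mass (letin (app (lam t) w) u)  = refl
red-mass (letin (t ⊕ t′) u)         = refl
red-mass (letin t@(letin _ _) u)    = avg-red-letin (λ _ → 1ℚ) t u refl ∙ red-mass t

avg-red-const : ∀ c t → avg (λ _ → c) (red t) ≡ c
avg-red-const c t = avg-const c (red t) ∙ cong (_* c) (red-mass t) ∙ ℚ.*-identityˡ c

steps-suc : ∀ k t → isValue t ≡ false → steps (suc k) t ≡ 1ℚ + avg (steps k) (red t)
steps-suc k t nv = cong (λ b → if b then 0ℚ else 1ℚ + avg (steps k) (red t)) nv

steps-val : ∀ k v → steps k (val v) ≡ 0ℚ
steps-val zero    v = refl
steps-val (suc k) v = refl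

steps-nonNeg : ∀ k t → 0ℚ ≤ steps k t
steps-nonNeg zero    t = ℚ.≤-refl
steps-nonNeg (suc k) t with isValue t
... | true  = ℚ.≤-refl
... | false = ℚ.+-mono-≤ 0≤1
  (≤-resp (avg-red-const 0ℚ t) refl (avg-mono {g = steps k} (red-nonNeg t) (steps-nonNeg k)))

steps-≤-suc : ∀ k t → steps k t ≤ steps (suc k) t
steps-≤-suc zero    t = steps-nonNeg 1 t
steps-≤-suc (suc k) t with isValue t
... | true  = ℚ.≤-refl
... | false = ℚ.+-monoʳ-≤ 1ℚ (avg-mono {steps k} (red-nonNeg t) (steps-≤-suc k))

steps-mono′ : ∀ {k l} → k ≤′ℕ l → ∀ t → steps k t ≤ steps l t
steps-mono′ (≤′-reflexive refl) t = ℚ.≤-refl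
steps-mono′ (≤′-step {l} k≤l) t = ℚ.≤-trans (steps-mono′ k≤l t) (steps-≤-suc l t)

steps-mono : ∀ {k l} → k ≤ℕ l → ∀ t → steps k t ≤ steps l t
steps-mono k≤l = steps-mono′ (ℕ.≤⇒≤′ k≤l)

-- Agreement of first-step and last-step counting

stopped : Term 0 → ℚ
stopped t = if isValue t then 1ℚ else 0ℚ

valMass≡avg : ∀ m → valMass m ≡ avg stopped m
valMass≡avg []            = refl
valMass≡avg ((p , t) ∷ m) with isValue t
... | true  = cong₂ _+_ (sym (ℚ.*-identityʳ p)) (valMass≡avg m)
... | false = cong₂ _+_ (sym (ℚ.*-zeroʳ p)) (valMass≡avg m)

mseq-mass : ∀ M k → avg (λ _ → 1ℚ) (mseq M k) ≡ 1ℚ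
mseq-mass M zero    = refl
mseq-mass M (suc k) = avg-liftStep _ (mseq M k) ∙ avg-cong red-mass (mseq M k) ∙ mseq-mass M k

-- The indicator of values makes up for the step that a value does not take. The recursion then
-- holds for all terms and can be integrated against `mseq M k`.
steps-stopped : ∀ j t → stopped t + steps (suc j) t ≡ 1ℚ + avg (steps j) (red t)
steps-stopped j (val v)       = cong (λ x → 1ℚ + x) (sym (avg-dirac (steps j) (val v) ∙ steps-val j v))
steps-stopped j (app v w)     = ℚ.+-identityˡ _
steps-stopped j (t ⊕ u)       = ℚ.+-identityˡ _
steps-stopped j (letin t u)   = ℚ.+-identityˡ _

avg-steps-suc : ∀ j M k → avg (steps (suc j)) (mseq M k) ≡ (1ℚ - Pk M k) + avg (steps j) (mseq M (suc k))
avg-steps-suc j M k = begin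
  b                              ≡⟨ solve 2 (λ a b → b := (a :+ b) :- a) refl a b ⟩
  (a + b) - a                    ≡⟨ cong (_- a) (sym (avg-+ stopped (steps (suc j)) m)) ⟩
  avg (λ t → stopped t + steps (suc j) t) m - a
                                 ≡⟨ cong (_- a) (avg-cong (steps-stopped j) m) ⟩
  avg (λ t → 1ℚ + avg (steps j) (red t)) m - a
                                 ≡⟨ cong (_- a) (avg-+ (λ _ → 1ℚ) _ m) ⟩
  (avg (λ _ → 1ℚ) m + avg (λ t → avg (steps j) (red t)) m) - a
                                 ≡⟨ cong₂ (λ x y → (x + y) - a) (mseq-mass M k) (sym (avg-liftStep (steps j) m)) ⟩
  (1ℚ + c) - a                   ≡⟨ solve 2 (λ a c → (con 1ℚ :+ c) :- a := (con 1ℚ :- a) :+ c) refl a c ⟩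
  (1ℚ - a) + c                   ≡⟨ cong (λ x → (1ℚ - x) + c) (sym (valMass≡avg m)) ⟩
  (1ℚ - Pk M k) + c              ∎
  where
  open ≡-Reasoning
  m = mseq M k
  a = avg stopped m
  b = avg (steps (suc j)) m
  c = avg (steps j) (mseq M (suc k))

-- The cost of the first k steps plus the expected cost of the next j. Each step of the induction
-- moves one unit from j to k, and j = 0 gives ℰₖ.
Ek+avg-steps : ∀ j M k → Ek M k + avg (steps j) (mseq M k) ≡ steps (k +ℕ j) M
Ek+avg-steps j M zero    = ℚ.+-identityˡ _ ∙ avg-dirac (steps j) M
Ek+avg-steps j M (suc k) = begin
  Ek M k + (1ℚ - Pk M k) + avg (steps j) (mseq M (suc k))   ≡⟨ ℚ.+-assoc (Ek M k) _ _ ⟩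
  Ek M k + ((1ℚ - Pk M k) + avg (steps j) (mseq M (suc k))) ≡⟨ cong (Ek M k +_) (sym (avg-steps-suc j M k)) ⟩
  Ek M k + avg (steps (suc j)) (mseq M k)                   ≡⟨ Ek+avg-steps (suc j) M k ⟩
  steps (k +ℕ suc j) M                                      ≡⟨ cong (λ l → steps l M) (ℕ.+-suc k j) ⟩
  steps (suc k +ℕ j) M                                      ∎
  where open ≡-Reasoning

Ek≡steps : ∀ M k → Ek M k ≡ steps k M
Ek≡steps M k = sym (ℚ.+-identityʳ _)
  ∙ cong (Ek M k +_) (sym (avg-const 0ℚ (mseq M k) ∙ ℚ.*-zeroʳ (avg (λ _ → 1ℚ) (mseq M k))))
  ∙ Ek+avg-steps 0 M k
  ∙ cong (λ l → steps l M) (ℕ.+-identityʳ k)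

-- Evaluation contexts

Stack : Set
Stack = List (Term 1)

-- The head of the stack is the innermost pending let.
plug : Term 0 → Stack → Term 0
plug t []      = t
plug t (u ∷ S) = plug (letin t u) S

fromℕ : ℕ → ℚ
fromℕ zero    = 0ℚ
fromℕ (suc n) = 1ℚ + fromℕ n

depth : Stack → ℚ
depth S = fromℕ (length S)

plug-nonValue : ∀ t S → isValue t ≡ false → isValue (plug t S) ≡ false
plug-nonValue t []      nv = nv
plug-nonValue t (u ∷ S) nv = plug-nonValue (letin t u) S refl

avg-red-plug : ∀ f t S → isValue t ≡ false
             → avg f (red (plug t S)) ≡ avg (λ t′ → f (plug t′ S)) (red t)
avg-red-plug f t []      nv = refl
avg-red-plug f t (u ∷ S) nv =
  avg-red-plug f (letin t u) S refl ∙ avg-red-letin (λ t′ → f (plug t′ S)) t u nv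

steps-plug : ∀ k t S → isValue t ≡ false
           → steps (suc k) (plug t S) ≡ 1ℚ + avg (λ t′ → steps k (plug t′ S)) (red t)
steps-plug k t S nv = steps-suc k (plug t S) (plug-nonValue t S nv)
  ∙ cong (1ℚ +_) (avg-red-plug (steps k) t S nv)

steps-plug-dirac : ∀ k t t′ S → isValue t ≡ false → red t ≡ (1ℚ , t′) ∷ []
                 → steps (suc k) (plug t S) ≡ 1ℚ + steps k (plug t′ S)
steps-plug-dirac k t t′ S nv eq = steps-plug k t S nv
  ∙ cong (λ m → 1ℚ + avg (λ t″ → steps k (plug t″ S)) m) eq
  ∙ cong (1ℚ +_) (avg-dirac (λ t″ → steps k (plug t″ S)) t′)

steps-plug-⊕ : ∀ k t u S
             → steps (suc k) (plug (t ⊕ u) S) ≡ 1ℚ + (½ * steps k (plug t S) + ½ * steps k (plug u S))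
steps-plug-⊕ k t u S = steps-plug k (t ⊕ u) S refl
  ∙ cong (λ x → 1ℚ + (½ * steps k (plug t S) + x)) (ℚ.+-identityʳ _)

-- Each pending let is still to be fired, whatever happens to the term in focus.
≤-steps-plug-nonValue : ∀ n t S → isValue t ≡ false → n ≤ℕ length S
                      → fromℕ (suc n) ≤ steps (suc n) (plug t S)
≤-steps-plug : ∀ n t S → n ≤ℕ length S → fromℕ n ≤ steps n (plug t S)
≤-steps-plug zero    t       S       le = ℚ.≤-refl
≤-steps-plug (suc n) (val v) (u ∷ S) (s≤ℕs le) =
  ≤-resp refl (sym (steps-plug-dirac n (letin (val v) u) (u [ v ]) S refl refl))
    (ℚ.+-monoʳ-≤ 1ℚ (≤-steps-plug n (u [ v ]) S le))
≤-steps-plug (suc n) t@(app _ _)   S le = ≤-steps-plug-nonValue n t S refl (ℕ.<⇒≤ le)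
≤-steps-plug (suc n) t@(_ ⊕ _)     S le = ≤-steps-plug-nonValue n t S refl (ℕ.<⇒≤ le)
≤-steps-plug (suc n) t@(letin _ _) S le = ≤-steps-plug-nonValue n t S refl (ℕ.<⇒≤ le)

-- A step of `t` leaves all of `S` pending and `red t` has mass 1, so the bound of the successors is
-- averaged without loss.
≤-steps-plug-nonValue n t S nv le =
  ≤-resp (cong (1ℚ +_) (avg-red-const (fromℕ n) t)) (sym (steps-plug n t S nv))
    (ℚ.+-monoʳ-≤ 1ℚ (avg-mono (red-nonNeg t) (λ t′ → ≤-steps-plug n t′ S le)))

-- Soundness

-- Lower bounds on ℰ(plug t S), not counting one step for each let of S. Without this discount the
-- + 1 of (let) would be lost on the mass missing from the type distribution of t.
record Obs (S : Stack) (t : Term 0) (r : ℚ) : Set where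
  constructor obs
  field
    bound        : ℕ
    depth+≤steps : r + depth S ≤ steps bound (plug t S)

Obs-resp : ∀ {S t r r′} → r ≡ r′ → Obs S t r → Obs S t r′
Obs-resp refl o = o

-- Because of the discount even the bound 0 has content: no branch can stop during the first
-- `length S` steps.
Obs-zero : ∀ S t → Obs S t 0ℚ
Obs-zero S t = obs (length S)
  (≤-resp (sym (ℚ.+-identityˡ _)) refl (≤-steps-plug (length S) t S ℕ.≤-refl))

Obs-dirac : ∀ {S t t′ r} → isValue t ≡ false → red t ≡ (1ℚ , t′) ∷ [] → Obs S t′ r → Obs S t (1ℚ + r)
Obs-dirac {S} {t} {t′} {r} nv eq (obs k le) = obs (suc k)
  (≤-resp (sym (ℚ.+-assoc 1ℚ r _)) (sym (steps-plug-dirac k t t′ S nv eq)) (ℚ.+-monoʳ-≤ 1ℚ le))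

-- The step that fires the let is paid by the discount of the popped `u`, so the bound stays the
-- same.
Obs-let : ∀ {S u v r} → Obs S (u [ v ]) r → Obs (u ∷ S) (val v) r
Obs-let {S} {u} {v} {r} (obs k le) = obs (suc k)
  (≤-resp (solve 2 (λ r d → con 1ℚ :+ (r :+ d) := r :+ (con 1ℚ :+ d)) refl r (depth S))
         (sym (steps-plug-dirac k (letin (val v) u) (u [ v ]) S refl refl))
         (ℚ.+-monoʳ-≤ 1ℚ le))

-- The plugged term is the same on both sides; the + 1 of (let) is the discount of the new stack
-- entry.
Obs-push : ∀ {S t u r} → Obs (u ∷ S) t r → Obs S (letin t u) (r + 1ℚ)
Obs-push {r = r} (obs k le) = obs k (≤-resp (sym (ℚ.+-assoc r 1ℚ _)) refl le)

Obs-⊕ : ∀ {S t u r r′} → Obs S t r → Obs S u r′ → Obs S (t ⊕ u) ((½ * r + ½ * r′) + 1ℚ)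
Obs-⊕ {S} {t} {u} {r} {r′} (obs k le) (obs k′ le′) = obs (suc (k ⊔ℕ k′))
  (≤-resp (solve 3 (λ r r′ d → con 1ℚ :+ (con ½ :* (r :+ d) :+ con ½ :* (r′ :+ d))
                              := ((con ½ :* r :+ con ½ :* r′) :+ con 1ℚ) :+ d) refl r r′ (depth S))
         (sym (steps-plug-⊕ (k ⊔ℕ k′) t u S))
         (ℚ.+-monoʳ-≤ 1ℚ (ℚ.+-mono-≤
           (*-mono-≤ 0≤½ (ℚ.≤-trans le  (steps-mono (ℕ.m≤m⊔n k k′) (plug t S))))
           (*-mono-≤ 0≤½ (ℚ.≤-trans le′ (steps-mono (ℕ.m≤n⊔m k k′) (plug u S)))))))

-- Terms are interpreted by orthogonality: ⟦ a ⟧D t w says that a stack whose cost on each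
-- 𝓜ₖ-value is at least cₖ has cost at least w + Σ pₖ cₖ on t.
mutual
  ⟦_⟧A : Arrow → Val 0 → ℚ → Set
  ⟦ M ⇒ b ⟧A V w = ∀ {W v} → ⟦ M ⟧M W v → ⟦ b ⟧D (app V W) (w + v)

  ⟦_⟧M : IType → Val 0 → ℚ → Set
  ⟦ []          ⟧M V w = w ≡ 0ℚ
  ⟦ (q , A) ∷ M ⟧M V w = ∃[ w₁ ] ∃[ w₂ ] (w ≡ q * w₁ + w₂ × ⟦ A ⟧A V w₁ × ⟦ M ⟧M V w₂)

  ⟦_⟧D : TDist → Term 0 → ℚ → Set
  ⟦ a ⟧D t w = ∀ S {c} → ⟦ a ⟧K S c → Obs S t (w + c)

  ⟦_⟧K : TDist → Stack → ℚ → Set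
  ⟦ []          ⟧K S c = c ≡ 0ℚ
  ⟦ (p , M) ∷ a ⟧K S c = ∃[ c₁ ] ∃[ c₂ ] (c ≡ p * c₁ + c₂
    × (∀ {V v} → ⟦ M ⟧M V v → Obs S (val V) (v + c₁)) × ⟦ a ⟧K S c₂)

+-exchange : ∀ x y z → x + (y + z) ≡ y + (x + z)
+-exchange = solve 3 (λ x y z → x :+ (y :+ z) := y :+ (x :+ z)) refl

mutual
  -- Both directions go together because interpretations are contravariant: the map forward on
  -- arrows uses the maps backward on values of the domain and on stacks of the codomain.
  ≈A⇒⇔ : ∀ {A A′} → A ≈A A′
        → ∀ {V w} → (⟦ A ⟧A V w → ⟦ A′ ⟧A V w) × (⟦ A′ ⟧A V w → ⟦ A ⟧A V w)
  ≈A⇒⇔ (arr M≈ a≈) =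
    (λ f m S c → f (proj₂ (≈M⇒⇔ M≈) m) S (proj₂ (≈D⇒⇔ a≈) c)) ,
    (λ f m S c → f (proj₁ (≈M⇒⇔ M≈) m) S (proj₁ (≈D⇒⇔ a≈) c))

  ≈M⇒⇔ : ∀ {M M′} → M ≈M M′
        → ∀ {V w} → (⟦ M ⟧M V w → ⟦ M′ ⟧M V w) × (⟦ M′ ⟧M V w → ⟦ M ⟧M V w)
  ≈M⇒⇔ [] = (λ e → e) , (λ e → e)
  ≈M⇒⇔ (cons refl A≈ M≈) =
    (λ (w₁ , w₂ , e , x , m) → w₁ , w₂ , e , proj₁ (≈A⇒⇔ A≈) x , proj₁ (≈M⇒⇔ M≈) m) ,
    (λ (w₁ , w₂ , e , x , m) → w₁ , w₂ , e , proj₂ (≈A⇒⇔ A≈) x , proj₂ (≈M⇒⇔ M≈) m)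
  ≈M⇒⇔ (swap {p , _} {q , _}) =
    (λ { (w₁ , _ , refl , x , w₂ , w₃ , refl , y , m) →
       w₂ , _ , +-exchange (p * w₁) (q * w₂) w₃ , y , w₁ , w₃ , refl , x , m }) ,
    (λ { (w₁ , _ , refl , x , w₂ , w₃ , refl , y , m) →
       w₂ , _ , +-exchange (q * w₁) (p * w₂) w₃ , y , w₁ , w₃ , refl , x , m })
  ≈M⇒⇔ (trans M≈ M≈′) =
    (λ m → proj₁ (≈M⇒⇔ M≈′) (proj₁ (≈M⇒⇔ M≈) m)) ,
    (λ m → proj₂ (≈M⇒⇔ M≈) (proj₂ (≈M⇒⇔ M≈′) m))

  ≈D⇒⇔ : ∀ {a a′} → a ≈D a′
        → ∀ {S c} → (⟦ a ⟧K S c → ⟦ a′ ⟧K S c) × (⟦ a′ ⟧K S c → ⟦ a ⟧K S c)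
  ≈D⇒⇔ [] = (λ e → e) , (λ e → e)
  ≈D⇒⇔ (cons refl M≈ a≈) =
    (λ (c₁ , c₂ , e , f , x) → c₁ , c₂ , e , (λ m → f (proj₂ (≈M⇒⇔ M≈) m)) , proj₁ (≈D⇒⇔ a≈) x) ,
    (λ (c₁ , c₂ , e , f , x) → c₁ , c₂ , e , (λ m → f (proj₁ (≈M⇒⇔ M≈) m)) , proj₂ (≈D⇒⇔ a≈) x)
  ≈D⇒⇔ (swap {p , _} {q , _}) =
    (λ { (c₁ , _ , refl , f , c₂ , c₃ , refl , g , x) →
       c₂ , _ , +-exchange (p * c₁) (q * c₂) c₃ , g , c₁ , c₃ , refl , f , x }) ,
    (λ { (c₁ , _ , refl , f , c₂ , c₃ , refl , g , x) →
       c₂ , _ , +-exchange (q * c₁) (p * c₂) c₃ , g , c₁ , c₃ , refl , f , x })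
  ≈D⇒⇔ (trans a≈ a≈′) =
    (λ x → proj₁ (≈D⇒⇔ a≈′) (proj₁ (≈D⇒⇔ a≈) x)) ,
    (λ x → proj₂ (≈D⇒⇔ a≈) (proj₂ (≈D⇒⇔ a≈′) x))

⟦⟧M-++ : ∀ M {N V w} → ⟦ M ++ N ⟧M V w → ∃[ w₁ ] ∃[ w₂ ] (w ≡ w₁ + w₂ × ⟦ M ⟧M V w₁ × ⟦ N ⟧M V w₂)
⟦⟧M-++ []            n = 0ℚ , _ , sym (ℚ.+-identityˡ _) , refl , n
⟦⟧M-++ ((q , A) ∷ M) (w₁ , _ , refl , x , m) with ⟦⟧M-++ M m
... | w₂ , w₃ , refl , m₂ , n = q * w₁ + w₂ , w₃ , sym (ℚ.+-assoc (q * w₁) w₂ w₃) , (w₁ , w₂ , refl , x , m₂) , n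

*-distrib-assoc : ∀ u q x y → u * q * x + u * y ≡ u * (q * x + y)
*-distrib-assoc = solve 4 (λ u q x y → u :* q :* x :+ u :* y := u :* (q :* x :+ y)) refl

⟦⟧M-scale : ∀ u M {V w} → ⟦ scaleM u M ⟧M V w → ∃[ w′ ] (w ≡ u * w′ × ⟦ M ⟧M V w′)
⟦⟧M-scale u []            refl = 0ℚ , sym (ℚ.*-zeroʳ u) , refl
⟦⟧M-scale u ((q , A) ∷ M) (w₁ , _ , refl , x , m) with ⟦⟧M-scale u M m
... | w₂ , refl , m′ = q * w₁ + w₂ , *-distrib-assoc u q w₁ w₂ , w₁ , w₂ , refl , x , m′

⟦⟧K-++ : ∀ a {b S c} → ⟦ a ++ b ⟧K S c → ∃[ c₁ ] ∃[ c₂ ] (c ≡ c₁ + c₂ × ⟦ a ⟧K S c₁ × ⟦ b ⟧K S c₂)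
⟦⟧K-++ []            y = 0ℚ , _ , sym (ℚ.+-identityˡ _) , refl , y
⟦⟧K-++ ((p , M) ∷ a) (c₁ , _ , refl , f , x) with ⟦⟧K-++ a x
... | c₂ , c₃ , refl , x₂ , y = p * c₁ + c₂ , c₃ , sym (ℚ.+-assoc (p * c₁) c₂ c₃) , (c₁ , c₂ , refl , f , x₂) , y

⟦⟧K-scale : ∀ u a {S c} → ⟦ scaleD u a ⟧K S c → ∃[ c′ ] (c ≡ u * c′ × ⟦ a ⟧K S c′)
⟦⟧K-scale u []            refl = 0ℚ , sym (ℚ.*-zeroʳ u) , refl
⟦⟧K-scale u ((p , M) ∷ a) (c₁ , _ , refl , f , x) with ⟦⟧K-scale u a x
... | c₂ , refl , x′ = p * c₁ + c₂ , *-distrib-assoc u p c₁ c₂ , c₁ , c₂ , refl , f , x′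

-- Realizability of typing derivations

⟦_⟧C : ∀ {n} → Ctx n → (Fin n → Val 0) → ℚ → Set
⟦ []    ⟧C σ r = r ≡ 0ℚ
⟦ M ∷ Γ ⟧C σ r = ∃[ r₁ ] ∃[ r₂ ] (r ≡ r₁ + r₂ × ⟦ M ⟧M (σ zero) r₁ × ⟦ Γ ⟧C (λ i → σ (suc i)) r₂)

+-interchange : ∀ a b c d → (a + b) + (c + d) ≡ (a + c) + (b + d)
+-interchange = solve 4 (λ a b c d → (a :+ b) :+ (c :+ d) := (a :+ c) :+ (b :+ d)) refl

⟦⟧C-⊎ : ∀ {n} (Γ : Ctx n) {Δ σ r} → ⟦ Γ ⊎C Δ ⟧C σ r
      → ∃[ r₁ ] ∃[ r₂ ] (r ≡ r₁ + r₂ × ⟦ Γ ⟧C σ r₁ × ⟦ Δ ⟧C σ r₂)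
⟦⟧C-⊎ []      {[]}    refl = 0ℚ , 0ℚ , refl , refl , refl
⟦⟧C-⊎ (M ∷ Γ) {N ∷ Δ} (_ , _ , refl , mn , γδ) with ⟦⟧M-++ M mn | ⟦⟧C-⊎ Γ γδ
... | m₁ , m₂ , refl , m , n | r₁ , r₂ , refl , γ , δ =
  m₁ + r₁ , m₂ + r₂ , +-interchange m₁ m₂ r₁ r₂ , (m₁ , r₁ , refl , m , γ) , (m₂ , r₂ , refl , n , δ)

⟦⟧C-scale : ∀ {n} u (Γ : Ctx n) {σ r} → ⟦ scaleC u Γ ⟧C σ r → ∃[ r′ ] (r ≡ u * r′ × ⟦ Γ ⟧C σ r′)
⟦⟧C-scale u []      refl = 0ℚ , sym (ℚ.*-zeroʳ u) , refl
⟦⟧C-scale u (M ∷ Γ) (_ , _ , refl , um , uγ) with ⟦⟧M-scale u M um | ⟦⟧C-scale u Γ uγ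
... | r₁ , refl , m | r₂ , refl , γ = r₁ + r₂ , sym (ℚ.*-distribˡ-+ u r₁ r₂) , r₁ , r₂ , refl , m , γ

⟦⟧C-∅ : ∀ {n σ r} → ⟦ ∅ {n} ⟧C σ r → r ≡ 0ℚ
⟦⟧C-∅ {zero}  e = e
⟦⟧C-∅ {suc n} (_ , _ , refl , refl , γ) = ℚ.+-identityˡ _ ∙ ⟦⟧C-∅ γ

⟦⟧C-single : ∀ {n} (i : Fin n) {M σ r} → ⟦ single i M ⟧C σ r → ⟦ M ⟧M (σ i) r
⟦⟧C-single zero    {M} {σ} (r₁ , r₂ , refl , m , γ) =
  subst (⟦ M ⟧M (σ zero)) (sym (ℚ.+-identityʳ r₁) ∙ cong (r₁ +_) (sym (⟦⟧C-∅ γ))) m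
⟦⟧C-single (suc i) {M} {σ} (_ , r₂ , refl , refl , γ) =
  subst (⟦ M ⟧M (σ (suc i))) (sym (ℚ.+-identityˡ r₂)) (⟦⟧C-single i γ)

⟦⟧C-≈ : ∀ {n} {Γ Γ′ : Ctx n} → Γ ≈C Γ′ → ∀ {σ r} → ⟦ Γ′ ⟧C σ r → ⟦ Γ ⟧C σ r
⟦⟧C-≈ []        e = e
⟦⟧C-≈ (M≈ ∷ Γ≈) (r₁ , r₂ , e , m , γ) = r₁ , r₂ , e , proj₂ (≈M⇒⇔ M≈) m , ⟦⟧C-≈ Γ≈ γ

mutual
  sound-A : ∀ {n Γ w V A} {σ : Fin n → Val 0} {r} → Γ ⊢A⟨ w ⟩ V ∶ A → ⟦ Γ ⟧C σ r → ⟦ A ⟧A (subV σ V) (w + r)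
  sound-A {σ = σ} {r} (lamR {w = w} {t = t} d) γ {W} {v} m S {c} k =
    -- The + 1 of (λ) pays for the β-step, taken when the abstraction meets an argument; (@) itself
    -- adds nothing.
    Obs-resp (solve 4 (λ w r v c → con 1ℚ :+ ((w :+ (v :+ r)) :+ c) := ((w :+ con 1ℚ :+ r) :+ v) :+ c) refl w r v c)
      (Obs-dirac refl refl
        (subst (λ t′ → Obs S t′ _) (sym (subT-[] t)) (sound {σ = σ ▹ W} d (v , r , refl , m , γ) S k)))
  sound-A (convA Γ≈ A≈ d) γ = proj₁ (≈A⇒⇔ A≈) (sound-A d (⟦⟧C-≈ Γ≈ γ))

  sound-M : ∀ {n Γ w V M} {σ : Fin n → Val 0} {r} → Γ ⊢M⟨ w ⟩ V ∶ M → ⟦ Γ ⟧C σ r → ⟦ M ⟧M (subV σ V) (w + r)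
  sound-M {r = r} (varR {i} {M} _) γ = subst (⟦ M ⟧M _) (sym (ℚ.+-identityˡ r)) (⟦⟧C-single i γ)
  sound-M (bangR ds)      γ = sound-Bang ds γ
  sound-M (convM Γ≈ M≈ d) γ = proj₁ (≈M⇒⇔ M≈) (sound-M d (⟦⟧C-≈ Γ≈ γ))

  sound-Bang : ∀ {n Γ w V M} {σ : Fin n → Val 0} {r} → Bang V M Γ w → ⟦ Γ ⟧C σ r → ⟦ M ⟧M (subV σ V) (w + r)
  sound-Bang [] γ = ℚ.+-identityˡ _ ∙ ⟦⟧C-∅ γ
  sound-Bang (cons {q} {Γ = Γ} {w = w} {v = v} _ _ d ds) γ with ⟦⟧C-⊎ (scaleC q Γ) γ
  ... | _ , r₂ , refl , qγ , δ with ⟦⟧C-scale q Γ qγ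
  ... | r₁ , refl , γ′ =
    w + r₁ , v + r₂ ,
    solve 5 (λ q w v r₁ r₂ → (q :* w :+ v) :+ (q :* r₁ :+ r₂) := q :* (w :+ r₁) :+ (v :+ r₂)) refl q w v r₁ r₂ ,
    sound-A d γ′ , sound-Bang ds δ

  sound : ∀ {n Γ w t a} {σ : Fin n → Val 0} {r} → Γ ⊢⟨ w ⟩ t ∶ a → ⟦ Γ ⟧C σ r → ⟦ a ⟧D (subT σ t) (w + r)
  sound {σ = σ} {r} (zeroR {t}) γ S {c} refl =
    Obs-resp (cong (λ x → 0ℚ + x + 0ℚ) (sym (⟦⟧C-∅ γ))) (Obs-zero S (subT σ t))
  sound (appR {Γ = Γ} {w = w} {v = v} d e) γδ S {c} k with ⟦⟧C-⊎ Γ γδ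
  ... | r₁ , r₂ , refl , γ , δ with sound-M d γ
  ... | w₁ , _ , eq , f , refl =
    Obs-resp (solve 4 (λ w₁ v r₂ c → w₁ :+ (v :+ r₂) :+ c := (con 1ℚ :* w₁ :+ con 0ℚ) :+ (v :+ r₂) :+ c) refl w₁ v r₂ c
              ∙ cong (λ x → x + (v + r₂) + c) (sym eq)
              ∙ cong (_+ c) (+-interchange w r₁ v r₂))
      (f (sound-M e δ) S k)
  sound (oplusR {Γ} {Δ} {w} {v} {a = a} d e) γδ S k
    with ⟦⟧C-⊎ (scaleC ½ Γ) γδ | ⟦⟧K-++ (scaleD ½ a) k
  ... | _ , _ , refl , γ , δ | _ , _ , refl , k₁ , k₂
    with ⟦⟧C-scale ½ Γ γ | ⟦⟧C-scale ½ Δ δ | ⟦⟧K-scale ½ a k₁ | ⟦⟧K-scale ½ _ k₂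
  ... | r₁ , refl , γ′ | r₂ , refl , δ′ | c₁ , refl , k₁′ | c₂ , refl , k₂′ =
    Obs-resp (solve 6 (λ w v r₁ r₂ c₁ c₂ →
                 (con ½ :* (w :+ r₁ :+ c₁) :+ con ½ :* (v :+ r₂ :+ c₂)) :+ con 1ℚ
                 := ((con ½ :* w :+ con ½ :* v) :+ con 1ℚ :+ (con ½ :* r₁ :+ con ½ :* r₂))
                    :+ (con ½ :* c₁ :+ con ½ :* c₂)) refl w v r₁ r₂ c₁ c₂)
      (Obs-⊕ (sound d γ′ S k₁′) (sound e δ′ S k₂′))
  sound (letR {Γ} {v = v} {ws} d ds) γδ S {c} k with ⟦⟧C-⊎ Γ γδ
  ... | r₁ , r₂ , refl , γ , δ =
    Obs-resp (solve 5 (λ v ws r₁ r₂ c → ((v :+ r₁) :+ ((ws :+ r₂) :+ c)) :+ con 1ℚ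
                                        := ((ws :+ v) :+ con 1ℚ :+ (r₁ :+ r₂)) :+ c) refl v ws r₁ r₂ c)
      -- The typing of the bound term is tested against the stack extended by the body.
      (Obs-push (sound d γ (_ ∷ S) (sound-Branches ds δ S k)))
  sound (valR {w = w} d) γ S (c₁ , _ , refl , f , refl) =
    Obs-resp (cong (w + _ +_) (solve 1 (λ c₁ → c₁ := con 1ℚ :* c₁ :+ con 0ℚ) refl c₁)) (f (sound-M d γ))
  sound (conv Γ≈ a≈ d) γ S k = sound d (⟦⟧C-≈ Γ≈ γ) S (proj₂ (≈D⇒⇔ a≈) k)

  -- The typed branches turn `u ∷ S` into a test for the type of the bound term: on an 𝓜ₖ-value its
  -- cost is the weight of the k-th branch, plus the potential of its context, plus the cost of `S`
  -- on the result.
  sound-Branches : ∀ {n u a Δ w b} {σ : Fin n → Val 0} {r} → Branches u a Δ w b → ⟦ Δ ⟧C σ r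
                 → ∀ S {c} → ⟦ b ⟧K S c → ⟦ a ⟧K (subT (extS σ) u ∷ S) (w + r + c)
  sound-Branches [] δ S refl = cong (λ x → 0ℚ + x + 0ℚ) (⟦⟧C-∅ δ)
  sound-Branches {u = u} {σ = σ} (cons {p} {Δ = Δ} {w = w} {ws} {b} d ds) δ S k
    with ⟦⟧C-⊎ (scaleC p Δ) δ | ⟦⟧K-++ (scaleD p b) k
  ... | _ , r₂ , refl , pδ , δs | _ , c₂ , refl , pk , ks
    with ⟦⟧C-scale p Δ pδ | ⟦⟧K-scale p b pk
  ... | r₁ , refl , δ′ | c₁ , refl , k′ =
    w + r₁ + c₁ , ws + r₂ + c₂ ,
    solve 7 (λ p w ws r₁ r₂ c₁ c₂ → (p :* w :+ ws) :+ (p :* r₁ :+ r₂) :+ (p :* c₁ :+ c₂)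
                                    := p :* (w :+ r₁ :+ c₁) :+ (ws :+ r₂ :+ c₂)) refl p w ws r₁ r₂ c₁ c₂ ,
    (λ {V} {v} m → Obs-resp
      (solve 4 (λ w v r₁ c₁ → (w :+ (v :+ r₁)) :+ c₁ := v :+ (w :+ r₁ :+ c₁)) refl w v r₁ c₁)
      (Obs-let (subst (λ t′ → Obs S t′ _) (sym (subT-[] u))
        (sound {σ = σ ▹ V} d (v , r₁ , refl , m , δ′) S k′)))) ,
    sound-Branches ds δs S ks

-- Completeness

-- Closed values are abstractions, so closures are the only values of the machine.
data Closure : Set where
  ⟨_,_⟩ : ∀ {n} → Term (suc n) → (Fin n → Closure) → Closure

Env : ℕ → Set
Env n = Fin n → Closure

eval : ∀ {n} → Val n → Env n → Closure
eval (var i) ρ = ρ i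
eval (lam t) ρ = ⟨ t , ρ ⟩

unload : Closure → Val 0
unload ⟨ t , ρ ⟩ = lam (subT (extS (λ i → unload (ρ i))) t)

unloadE : ∀ {n} → Env n → Fin n → Val 0
unloadE ρ i = unload (ρ i)

unload-eval : ∀ {n} (V : Val n) ρ → unload (eval V ρ) ≡ subV (unloadE ρ) V
unload-eval (var i) ρ = refl
unload-eval (lam t) ρ = refl

unloadE-▹ : ∀ {n} (ρ : Env n) c i → (unloadE ρ ▹ unload c) i ≡ unloadE (ρ ▹ c) i
unloadE-▹ ρ c zero    = refl
unloadE-▹ ρ c (suc i) = refl

subT-unload-[] : ∀ {n} (t : Term (suc n)) ρ {m} (V : Val m) (ρ′ : Env m)
               → (subT (extS (unloadE ρ)) t) [ subV (unloadE ρ′) V ] ≡ subT (unloadE (ρ ▹ eval V ρ′)) t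
subT-unload-[] t ρ V ρ′ = cong (_ [_]) (sym (unload-eval V ρ′)) ∙ subT-[] t ∙ subT-cong (unloadE-▹ ρ _) t

data EnvStack : Set where
  []   : EnvStack
  push : ∀ {n} → Term (suc n) → Env n → EnvStack → EnvStack

unloadS : EnvStack → Stack
unloadS []           = []
unloadS (push u ρ S) = subT (extS (unloadE ρ)) u ∷ unloadS S

WFD : TDist → Set
WFD a = WFD' a × sumP a ≤ 1ℚ

-- Typing of closures, environments and stacks

mutual
  -- Well-formedness is recorded in `clo` because (Var) demands it once a variable denotes this
  -- closure.
  data _∶A⟨_⟩_ : Closure → ℚ → Arrow → Set where
    clo : ∀ {n t} {ρ : Env n} {Γ M b w r} → (M ∷ Γ) ⊢⟨ w ⟩ t ∶ b → ρ ∶C⟨ r ⟩ Γ → WFM M → WFD b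
        → ⟨ t , ρ ⟩ ∶A⟨ w + 1ℚ + r ⟩ (M ⇒ b)

  data _∶M⟨_⟩_ (c : Closure) : ℚ → IType → Set where
    []   : c ∶M⟨ 0ℚ ⟩ []
    cons : ∀ {q A M w v} → 0ℚ < q → q ≤ 1ℚ → c ∶A⟨ w ⟩ A → c ∶M⟨ v ⟩ M → c ∶M⟨ q * w + v ⟩ ((q , A) ∷ M)

  data _∶C⟨_⟩_ : ∀ {n} → Env n → ℚ → Ctx n → Set where
    []  : ∀ {ρ} → ρ ∶C⟨ 0ℚ ⟩ []
    _∷_ : ∀ {n} {ρ : Env (suc n)} {M Γ v r} → ρ zero ∶M⟨ v ⟩ M → (λ i → ρ (suc i)) ∶C⟨ r ⟩ Γ
        → ρ ∶C⟨ v + r ⟩ (M ∷ Γ)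

-- The index is the type expected of the term in focus; the empty stack expects the empty type
-- distribution. The 1 in `push` is the + 1 of a (let) still to be closed.
data _∶S⟨_⟩_ : EnvStack → ℚ → TDist → Set where
  []   : [] ∶S⟨ 0ℚ ⟩ []
  push : ∀ {n u} {ρ : Env n} {S a Δ b w r s} → Branches u a Δ w b → ρ ∶C⟨ r ⟩ Δ → WFD b → S ∶S⟨ s ⟩ b
       → push u ρ S ∶S⟨ 1ℚ + w + r + s ⟩ a

∶A⇒WFA : ∀ {c w A} → c ∶A⟨ w ⟩ A → WFA A
∶A⇒WFA (clo _ _ wfM (wfb , sum≤1)) = wfM , wfb , sum≤1

∶M⇒WFM : ∀ {c w M} → c ∶M⟨ w ⟩ M → WFM M
∶M⇒WFM []                = tt
∶M⇒WFM (cons 0<q q≤1 x m) = (0<q , q≤1 , ∶A⇒WFA x) , ∶M⇒WFM m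

0<* : ∀ {p q} → 0ℚ < p → 0ℚ < q → 0ℚ < p * q
0<* {p} {q} 0<p 0<q = ℚ.positive⁻¹ (p * q) {{ℚ.pos*pos⇒pos p {{positive 0<p}} q {{positive 0<q}}}}

*≤1 : ∀ {p q} → 0ℚ < p → p ≤ 1ℚ → q ≤ 1ℚ → p * q ≤ 1ℚ
*≤1 {p} 0<p p≤1 q≤1 =
  ℚ.≤-trans (*-mono-≤ (ℚ.<⇒≤ 0<p) q≤1) (≤-resp (sym (ℚ.*-identityʳ p)) refl p≤1)

∶M-++ : ∀ {c w v M N} → c ∶M⟨ w ⟩ M → c ∶M⟨ v ⟩ N → c ∶M⟨ w + v ⟩ (M ++ N)
∶M-++ {c} {N = N} [] n = subst (λ x → c ∶M⟨ x ⟩ N) (sym (ℚ.+-identityˡ _)) n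
∶M-++ (cons {q} {w = w} {v} 0<q q≤1 x m) n =
  subst (λ x → _ ∶M⟨ x ⟩ _) (sym (ℚ.+-assoc (q * w) v _)) (cons 0<q q≤1 x (∶M-++ m n))

∶M-scale : ∀ {c u w M} → 0ℚ < u → u ≤ 1ℚ → c ∶M⟨ w ⟩ M → c ∶M⟨ u * w ⟩ scaleM u M
∶M-scale {c} {u} 0<u u≤1 [] = subst (λ x → c ∶M⟨ x ⟩ []) (sym (ℚ.*-zeroʳ u)) []
∶M-scale {u = u} 0<u u≤1 (cons {q} {w = w} {v} 0<q q≤1 x m) =
  subst (λ x → _ ∶M⟨ x ⟩ _) (*-distrib-assoc u q w v)
    (cons (0<* 0<u 0<q) (*≤1 0<u u≤1 q≤1) x (∶M-scale 0<u u≤1 m))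

∶C-⊎ : ∀ {n} {ρ : Env n} {w v Γ Δ} → ρ ∶C⟨ w ⟩ Γ → ρ ∶C⟨ v ⟩ Δ → ρ ∶C⟨ w + v ⟩ (Γ ⊎C Δ)
∶C-⊎ [] [] = []
∶C-⊎ (_∷_ {v = v} {r} m γ) (_∷_ {v = v′} {r′} n δ) =
  subst (λ x → _ ∶C⟨ x ⟩ _) (+-interchange v v′ r r′) (∶M-++ m n ∷ ∶C-⊎ γ δ)

∶C-scale : ∀ {n} {ρ : Env n} {u w Γ} → 0ℚ < u → u ≤ 1ℚ → ρ ∶C⟨ w ⟩ Γ → ρ ∶C⟨ u * w ⟩ scaleC u Γ
∶C-scale {u = u} 0<u u≤1 [] = subst (λ x → _ ∶C⟨ x ⟩ _) (sym (ℚ.*-zeroʳ u)) []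
∶C-scale {u = u} 0<u u≤1 (_∷_ {v = v} {r} m γ) =
  subst (λ x → _ ∶C⟨ x ⟩ _) (sym (ℚ.*-distribˡ-+ u v r)) (∶M-scale 0<u u≤1 m ∷ ∶C-scale 0<u u≤1 γ)

∶C-∅ : ∀ {n} {ρ : Env n} → ρ ∶C⟨ 0ℚ ⟩ ∅
∶C-∅ {zero}  = []
∶C-∅ {suc n} = [] ∷ ∶C-∅ {n}

∶C-single : ∀ {n} {ρ : Env n} i {w M} → ρ i ∶M⟨ w ⟩ M → ρ ∶C⟨ w ⟩ single i M
∶C-single zero    m = subst (λ x → _ ∶C⟨ x ⟩ _) (ℚ.+-identityʳ _) (m ∷ ∶C-∅)
∶C-single (suc i) m = subst (λ x → _ ∶C⟨ x ⟩ _) (ℚ.+-identityˡ _) ([] ∷ ∶C-single i m)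

eval-∶M-lam : ∀ {n t} {ρ : Env n} {w M} → ⟨ t , ρ ⟩ ∶M⟨ w ⟩ M
            → ∃[ Γ ] ∃[ v ] ∃[ r ] (Bang (lam t) M Γ v × ρ ∶C⟨ r ⟩ Γ × w ≡ v + r)
eval-∶M-lam [] = ∅ , 0ℚ , 0ℚ , [] , ∶C-∅ , refl
eval-∶M-lam (cons {q} 0<q q≤1 (clo {w = w} {r} d γ _ _) m) with eval-∶M-lam m
... | Δ , v , s , ds , δ , refl = _ , _ , _ , cons 0<q q≤1 (lamR d) ds , ∶C-⊎ (∶C-scale 0<q q≤1 γ) δ ,
  solve 5 (λ q w r v s → q :* (w :+ con 1ℚ :+ r) :+ (v :+ s) := (q :* (w :+ con 1ℚ) :+ v) :+ (q :* r :+ s))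
    refl q w r v s

-- This stands in for anti-substitution. The weight of a closure splits between the syntactic value
-- and its environment: for a variable all of it lies in the environment, for an abstraction the
-- typings of the individual copies are collected by (!).
eval-∶M : ∀ {n} V {ρ : Env n} {w M} → eval V ρ ∶M⟨ w ⟩ M
        → ∃[ Γ ] ∃[ v ] ∃[ r ] (Γ ⊢M⟨ v ⟩ V ∶ M × ρ ∶C⟨ r ⟩ Γ × w ≡ v + r)
eval-∶M (var i) m = _ , _ , _ , varR (∶M⇒WFM m) , ∶C-single i m , sym (ℚ.+-identityˡ _)
eval-∶M (lam t) m with eval-∶M-lam m
... | _ , _ , _ , ds , γ , eq = _ , _ , _ , bangR ds , γ , eq

-- Scaling and merging of typings

scaleM-∘ : ∀ u v M → scaleM (u * v) M ≡ scaleM u (scaleM v M)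
scaleM-∘ u v []            = refl
scaleM-∘ u v ((q , A) ∷ M) = cong₂ _∷_ (cong (_, A) (ℚ.*-assoc u v q)) (scaleM-∘ u v M)

scaleD-∘ : ∀ u v a → scaleD (u * v) a ≡ scaleD u (scaleD v a)
scaleD-∘ u v []            = refl
scaleD-∘ u v ((p , M) ∷ a) = cong₂ _∷_ (cong (_, M) (ℚ.*-assoc u v p)) (scaleD-∘ u v a)

scaleD-1 : ∀ a → scaleD 1ℚ a ≡ a
scaleD-1 []            = refl
scaleD-1 ((p , M) ∷ a) = cong₂ _∷_ (cong (_, M) (ℚ.*-identityˡ p)) (scaleD-1 a)

⊎-assoc : ∀ {n} (Γ Δ Θ : Ctx n) → (Γ ⊎C Δ) ⊎C Θ ≡ Γ ⊎C (Δ ⊎C Θ)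
⊎-assoc = Vec.zipWith-assoc List.++-assoc

∅-⊎ : ∀ {n} (Γ : Ctx n) → ∅ ⊎C Γ ≡ Γ
∅-⊎ = Vec.zipWith-identityˡ (λ _ → refl)

scaleC-∅ : ∀ {n} u → scaleC u (∅ {n}) ≡ ∅
scaleC-∅ {n} u = Vec.map-replicate (scaleM u) [] n

scaleC-⊎ : ∀ {n} u v (Γ Δ : Ctx n) → scaleC (u * v) Γ ⊎C scaleC u Δ ≡ scaleC u (scaleC v Γ ⊎C Δ)
scaleC-⊎ u v []      []      = refl
scaleC-⊎ u v (M ∷ Γ) (N ∷ Δ) = cong₂ _∷_
  (cong (_++ scaleM u N) (scaleM-∘ u v M) ∙ sym (List.map-++ _ (scaleM v M) N)) (scaleC-⊎ u v Γ Δ)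

scaleD-++ : ∀ u v a b → scaleD (u * v) a ++ scaleD u b ≡ scaleD u (scaleD v a ++ b)
scaleD-++ u v a b = cong (_++ scaleD u b) (scaleD-∘ u v a) ∙ sym (List.map-++ _ (scaleD v a) b)

Branches-resp : ∀ {n} {t : Term (suc n)} {a Γ Γ′ w w′ b b′}
              → Γ ≡ Γ′ → w ≡ w′ → b ≡ b′ → Branches t a Γ w b → Branches t a Γ′ w′ b′
Branches-resp refl refl refl ds = ds

-- Only the outer probabilities change; the derivations of the branches are kept.
Branches-scale : ∀ {n} {t : Term (suc n)} {a Γ w b} u
               → Branches t a Γ w b → Branches t (scaleD u a) (scaleC u Γ) (u * w) (scaleD u b)
Branches-scale u [] = Branches-resp (sym (scaleC-∅ u)) (sym (ℚ.*-zeroʳ u)) refl []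
Branches-scale u (cons {p} {Δ = Δ} {Δs} {w} {ws} {b} {bs} d ds) =
  Branches-resp (scaleC-⊎ u p Δ Δs) (*-distrib-assoc u p w ws) (scaleD-++ u p b bs)
    (cons d (Branches-scale u ds))

Branches-++ : ∀ {n} {t : Term (suc n)} {a a′ Γ Γ′ w w′ b b′} → Branches t a Γ w b → Branches t a′ Γ′ w′ b′
            → Branches t (a ++ a′) (Γ ⊎C Γ′) (w + w′) (b ++ b′)
Branches-++ [] es = Branches-resp (sym (∅-⊎ _)) (sym (ℚ.+-identityˡ _)) refl es
Branches-++ (cons {p} {Δ = Δ} {Δs} {w} {ws} {b} {bs} d ds) es =
  Branches-resp (sym (⊎-assoc (scaleC p Δ) Δs _)) (sym (ℚ.+-assoc (p * w) ws _))
    (sym (List.++-assoc (scaleD p b) bs _)) (cons d (Branches-++ ds es))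

0<½ : 0ℚ < ½
0<½ = from-yes (0ℚ ℚ.<? ½)

½≤1 : ½ ≤ 1ℚ
½≤1 = from-yes (½ ℚ.≤? 1ℚ)

0<1 : 0ℚ < 1ℚ
0<1 = from-yes (0ℚ ℚ.<? 1ℚ)

WFD'-scale : ∀ {u} a → 0ℚ < u → u ≤ 1ℚ → WFD' a → WFD' (scaleD u a)
WFD'-scale []            0<u u≤1 wf = tt
WFD'-scale ((p , M) ∷ a) 0<u u≤1 ((0<p , p≤1 , wfM) , wfa) =
  (0<* 0<u 0<p , *≤1 0<u u≤1 p≤1 , wfM) , WFD'-scale a 0<u u≤1 wfa

WFD'-++ : ∀ a {b} → WFD' a → WFD' b → WFD' (a ++ b)
WFD'-++ []      wfa       wfb = wfb
WFD'-++ (_ ∷ a) (wf , wfa) wfb = wf , WFD'-++ a wfa wfb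

sumP-scale : ∀ u a → sumP (scaleD u a) ≡ u * sumP a
sumP-scale u []            = sym (ℚ.*-zeroʳ u)
sumP-scale u ((p , M) ∷ a) = cong (u * p +_) (sumP-scale u a) ∙ sym (ℚ.*-distribˡ-+ u p _)

sumP-++ : ∀ a b → sumP (a ++ b) ≡ sumP a + sumP b
sumP-++ []            b = sym (ℚ.+-identityˡ _)
sumP-++ ((p , M) ∷ a) b = cong (p +_) (sumP-++ a b) ∙ sym (ℚ.+-assoc p _ _)

_½⊔½_ : TDist → TDist → TDist
a ½⊔½ b = scaleD ½ a ++ scaleD ½ b

WFD-½⊔½ : ∀ {a b} → WFD a → WFD b → WFD (a ½⊔½ b)
WFD-½⊔½ {a} {b} (wfa , sa) (wfb , sb) =
  WFD'-++ (scaleD ½ a) (WFD'-scale a 0<½ ½≤1 wfa) (WFD'-scale b 0<½ ½≤1 wfb) ,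
  ≤-resp (cong₂ _+_ (sym (sumP-scale ½ a)) (sym (sumP-scale ½ b)) ∙ sym (sumP-++ (scaleD ½ a) _)) refl
    (ℚ.+-mono-≤ (*-mono-≤ 0≤½ sa) (*-mono-≤ 0≤½ sb))

-- The two outcomes of a choice share a stack but may type it differently. Its let bodies receive
-- the branches of both typings at half probability, and the 1 of each let survives as ½ + ½.
∶S-½⊔½ : ∀ {S a b s s′} → S ∶S⟨ s ⟩ a → S ∶S⟨ s′ ⟩ b → S ∶S⟨ ½ * s + ½ * s′ ⟩ (a ½⊔½ b)
∶S-½⊔½ [] [] = []
∶S-½⊔½ (push {w = w} {r} {s} ds γ wfb x) (push {w = w′} {r′} {s′} es δ wfb′ y) =
  subst (λ z → _ ∶S⟨ z ⟩ _)
    (solve 6 (λ w r s w′ r′ s′ →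
        con 1ℚ :+ (con ½ :* w :+ con ½ :* w′) :+ (con ½ :* r :+ con ½ :* r′) :+ (con ½ :* s :+ con ½ :* s′)
        := con ½ :* (con 1ℚ :+ w :+ r :+ s) :+ con ½ :* (con 1ℚ :+ w′ :+ r′ :+ s′)) refl w r s w′ r′ s′)
    (push (Branches-++ (Branches-scale ½ ds) (Branches-scale ½ es))
          (∶C-⊎ (∶C-scale 0<½ ½≤1 γ) (∶C-scale 0<½ ½≤1 δ))
          (WFD-½⊔½ wfb wfb′) (∶S-½⊔½ x y))

-- The empty type distribution leaves no branch to type, yet each pending let keeps its 1.
depth-∶S : ∀ S → S ∶S⟨ depth (unloadS S) ⟩ []
depth-∶S []           = []
depth-∶S (push u ρ S) = subst (λ z → push u ρ S ∶S⟨ z ⟩ [])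
  (solve 1 (λ d → con 1ℚ :+ con 0ℚ :+ con 0ℚ :+ d := con 1ℚ :+ d) refl (depth (unloadS S)))
  (push [] ∶C-∅ (tt , 0≤1) (depth-∶S S))

-- Pulling typings back along machine steps

record Typed {n} (t : Term n) (ρ : Env n) (S : EnvStack) (e : ℚ) : Set where
  constructor typed
  field
    {Γ}     : Ctx n
    {a}     : TDist
    {w r s} : ℚ
    term    : Γ ⊢⟨ w ⟩ t ∶ a
    env     : ρ ∶C⟨ r ⟩ Γ
    wf      : WFD a
    stack   : S ∶S⟨ s ⟩ a
    bound   : e ≤ w + r + s

fromℕ-nonNeg : ∀ n → 0ℚ ≤ fromℕ n
fromℕ-nonNeg zero    = ℚ.≤-refl
fromℕ-nonNeg (suc n) = ℚ.+-mono-≤ 0≤1 (fromℕ-nonNeg n)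

-- The pending lets already weigh their number, which is why `Typed` asks for an inequality.
Typed-zero : ∀ {n} {t : Term n} {ρ} S → Typed t ρ S 0ℚ
Typed-zero S = typed zeroR ∶C-∅ (tt , 0≤1) (depth-∶S S)
  (≤-resp refl (sym (ℚ.+-identityˡ _)) (fromℕ-nonNeg (length (unloadS S))))

Typed-resp : ∀ {n} {t : Term n} {ρ S e e′} → e ≡ e′ → Typed t ρ S e → Typed t ρ S e′
Typed-resp refl x = x

Typed-app : ∀ {n m} {V W : Val n} {ρ : Env n} {t : Term (suc m)} {ρ′ : Env m} {S e}
          → eval V ρ ≡ ⟨ t , ρ′ ⟩ → Typed t (ρ′ ▹ eval W ρ) S e → Typed (app V W) ρ S (1ℚ + e)
Typed-app {V = V} {W} {ρ} {t} {ρ′} {e = e} eq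
  (typed {w = w} {s = s} d (_∷_ {M = M} {v = v} {r} m γ) wf x le)
  -- The body and the rest of its environment form a closure of type [1·(M ⇒ a)], whose + 1 is the
  -- β-step; it is then pulled back to `V`, and the typing of the argument to `W`.
  with eval-∶M V (subst (λ c → c ∶M⟨ 1ℚ * (w + 1ℚ + r) + 0ℚ ⟩ _) (sym eq) (cons 0<1 ℚ.≤-refl (clo d γ (∶M⇒WFM m) wf) [])) | eval-∶M W m
... | _ , v₁ , r₁ , dV , γV , eq₁ | _ , v₂ , r₂ , dW , γW , refl =
  typed (appR dV dW) (∶C-⊎ γV γW) wf x (≤-resp refl eq₂ (ℚ.+-monoʳ-≤ 1ℚ le))
  where
  open ≡-Reasoning
  eq₂ : 1ℚ + (w + ((v₂ + r₂) + r) + s) ≡ v₁ + v₂ + (r₁ + r₂) + s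
  eq₂ = begin
    1ℚ + (w + ((v₂ + r₂) + r) + s)
      ≡⟨ solve 5 (λ w v₂ r₂ r s → con 1ℚ :+ (w :+ ((v₂ :+ r₂) :+ r) :+ s)
           := (con 1ℚ :* (w :+ con 1ℚ :+ r) :+ con 0ℚ) :+ (v₂ :+ r₂) :+ s) refl w v₂ r₂ r s ⟩
    (1ℚ * (w + 1ℚ + r) + 0ℚ) + (v₂ + r₂) + s ≡⟨ cong (λ x → x + (v₂ + r₂) + s) eq₁ ⟩
    (v₁ + r₁) + (v₂ + r₂) + s                ≡⟨ cong (_+ s) (+-interchange v₁ r₁ v₂ r₂) ⟩
    v₁ + v₂ + (r₁ + r₂) + s                  ∎

Typed-⊕ : ∀ {n} {t u : Term n} {ρ S e e′} → Typed t ρ S e → Typed u ρ S e′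
        → Typed (t ⊕ u) ρ S (1ℚ + (½ * e + ½ * e′))
Typed-⊕ (typed {w = w} {r} {s} d γ wfa x le) (typed {w = w′} {r′} {s′} d′ γ′ wfa′ x′ le′) =
  typed (oplusR d d′) (∶C-⊎ (∶C-scale 0<½ ½≤1 γ) (∶C-scale 0<½ ½≤1 γ′)) (WFD-½⊔½ wfa wfa′) (∶S-½⊔½ x x′)
    (≤-resp refl
      (solve 6 (λ w r s w′ r′ s′ →
         con 1ℚ :+ (con ½ :* (w :+ r :+ s) :+ con ½ :* (w′ :+ r′ :+ s′))
         := ((con ½ :* w :+ con ½ :* w′) :+ con 1ℚ) :+ (con ½ :* r :+ con ½ :* r′) :+ (con ½ :* s :+ con ½ :* s′))
         refl w r s w′ r′ s′)
      (ℚ.+-monoʳ-≤ 1ℚ (ℚ.+-mono-≤ (*-mono-≤ 0≤½ le) (*-mono-≤ 0≤½ le′))))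

-- Moving focus to the bound term is not a reduction step, so `e` is kept; the 1 passes from the
-- stack to the rule (let).
Typed-let : ∀ {n} {t : Term n} {u ρ S e} → Typed t ρ (push u ρ S) e → Typed (letin t u) ρ S e
Typed-let (typed {w = v} {r₁} d γ wfa (push {w = w} {r} {s} ds δ wfb x) le) =
  typed (letR d ds) (∶C-⊎ γ δ) wfb x
    (≤-resp refl (solve 5 (λ v r₁ w r s → v :+ r₁ :+ (con 1ℚ :+ w :+ r :+ s)
                                          := ((w :+ v) :+ con 1ℚ) :+ (r₁ :+ r) :+ s) refl v r₁ w r s) le)

-- A value has a type of the form ⟨1 M⟩, so the fired let becomes a single branch of probability 1,
-- with the 1 of `push` as the step.
Typed-return : ∀ {n m} {V : Val n} {ρ : Env n} {u : Term (suc m)} {ρ′ : Env m} {S e}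
             → Typed u (ρ′ ▹ eval V ρ) S e → Typed (val V) ρ (push u ρ′ S) (1ℚ + e)
Typed-return {V = V} {S = S} (typed {a = b} {w} {s = s} d (_∷_ {r = r} m γ) wfb x le) with eval-∶M V m
... | _ , v₁ , r₁ , dV , γV , refl =
  typed (valR dV) γV (((0<1 , ℚ.≤-refl , ∶M⇒WFM m) , tt) , ℚ.≤-refl) (push (cons d [])
      (∶C-⊎ (∶C-scale 0<1 ℚ.≤-refl γ) ∶C-∅) (subst WFD (sym eq) wfb) (subst (S ∶S⟨ s ⟩_) (sym eq) x))
    (≤-resp refl (solve 5 (λ w v₁ r₁ r s → con 1ℚ :+ (w :+ ((v₁ :+ r₁) :+ r) :+ s)
        := v₁ :+ r₁ :+ (con 1ℚ :+ (con 1ℚ :* w :+ con 0ℚ) :+ (con 1ℚ :* r :+ con 0ℚ) :+ s)) refl w v₁ r₁ r s)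
      (ℚ.+-monoʳ-≤ 1ℚ le))
  where
  eq : scaleD 1ℚ b ++ [] ≡ b
  eq = List.++-identityʳ _ ∙ scaleD-1 b

-- Induction on k, then on the term: entering a let keeps k and shrinks the term, while every
-- reduction step lowers k.
complete : ∀ k {n} (t : Term n) ρ S → Typed t ρ S (steps k (plug (subT (unloadE ρ) t) (unloadS S)))
complete zero    t           ρ S  = Typed-zero S
complete (suc k) (val V)     ρ [] = Typed-zero []
complete (suc k) (val V)     ρ (push u ρ′ S) =
  Typed-resp (cong (λ t → 1ℚ + steps k (plug t (unloadS S))) (sym (subT-unload-[] u ρ′ V ρ))
      ∙ sym (steps-plug-dirac k (letin (subT (unloadE ρ) (val V)) (subT (extS (unloadE ρ′)) u)) _ (unloadS S) refl refl))
    (Typed-return {V = V} (complete k u (ρ′ ▹ eval V ρ) S))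
complete (suc k) (app V W) ρ S with eval V ρ in eq
... | ⟨ t , ρ′ ⟩ =
  Typed-resp (cong (λ t′ → 1ℚ + steps k (plug t′ (unloadS S))) (sym (subT-unload-[] t ρ′ W ρ))
      ∙ sym (steps-plug-dirac k (app (lam (subT (extS (unloadE ρ′)) t)) (subV (unloadE ρ) W)) _ (unloadS S) refl refl)
      ∙ cong (λ V′ → steps (suc k) (plug (app V′ (subV (unloadE ρ) W)) (unloadS S)))
             (sym (cong unload eq) ∙ unload-eval V ρ))
    (Typed-app {V = V} {W} eq (complete k t (ρ′ ▹ eval W ρ) S))
complete (suc k) (t ⊕ u)     ρ S =
  Typed-resp (sym (steps-plug-⊕ k _ _ (unloadS S))) (Typed-⊕ (complete k t ρ S) (complete k u ρ S))
complete k@(suc _) (letin t u) ρ S = Typed-let (complete k t ρ (push u ρ S))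

-- Comparison of the two suprema

Ek-typable : ∀ M k → ∃[ w ] (TypeWeights M w × Ek M k ≤ w)
Ek-typable M k with complete k M (λ ()) []
-- The empty stack forces the type to be the empty type distribution.
... | typed {w = w} d [] _ [] le = w , d ,
  ≤-resp (cong (steps k) (subT-id (λ ()) M) ∙ sym (Ek≡steps M k))
         (ℚ.+-identityʳ _ ∙ ℚ.+-identityʳ w) le

weight-≤-Ek : ∀ M {w} → TypeWeights M w → ∃[ k ] (w ≤ Ek M k)
-- The empty stack is a test of cost 0, and its depth is 0, so nothing is discounted.
weight-≤-Ek M {w} d with sound {σ = λ ()} d refl [] refl
... | obs k le = k ,
  ≤-resp (ℚ.+-identityʳ _ ∙ ℚ.+-identityʳ _ ∙ ℚ.+-identityʳ w)
         (cong (steps k) (subT-id (λ ()) M) ∙ sym (Ek≡steps M k)) le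

mainTheorem14 : (M : Term 0)
    → SameSup (ExpSteps M) (TypeWeights M)
    × (PAST M ⇔ SupFinite (TypeWeights M))
mainTheorem14 M = sameSup , mk⇔ past⇒ ⇒past
  where
  sameSup : SameSup (ExpSteps M) (TypeWeights M)
  sameSup q = mk⇔ to from
    where
    to : ∃[ e ] (ExpSteps M e × q < e) → ∃[ w ] (TypeWeights M w × q < w)
    to (_ , (k , refl) , q<e) with Ek-typable M k
    ... | w , d , e≤w = w , d , ℚ.<-≤-trans q<e e≤w

    from : ∃[ w ] (TypeWeights M w × q < w) → ∃[ e ] (ExpSteps M e × q < e)
    from (w , d , q<w) with weight-≤-Ek M d
    ... | k , w≤e = Ek M k , (k , refl) , ℚ.<-≤-trans q<w w≤e

  past⇒ : PAST M → SupFinite (TypeWeights M)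
  past⇒ (B , ub) = B , λ w d → let k , w≤e = weight-≤-Ek M d in ℚ.≤-trans w≤e (ub _ (k , refl))

  ⇒past : SupFinite (TypeWeights M) → PAST M
  ⇒past (B , ub) = B , λ { _ (k , refl) → let w , d , e≤w = Ek-typable M k in ℚ.≤-trans e≤w (ub w d) }
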